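{- Let $n$, $k$, and $d$ be non-negative integers such that $k\le n$, let $N$ be a sorting network of width $n$ and depth $d$, let $\mathrm{ASP}(N)$ be the translation of $N$ into an answer set program, let $P^n_k$ be the binomial program on the atoms $\mathtt{x}_{10},\dots,\mathtt{x}_{n0}$, let $\pi$ be a propagator for the constraint $$\bigl\{\{\mathbf{T}x\mid x\in X\}\ \bigm|\ X\subseteq\{\mathtt{x}_{1d},\dots,\mathtt{x}_{nd}\},\ |X|=k\bigr\},$$ and let $A_1,\dots,A_m$ be a complete propagator call history for $\mathrm{ASP}(N)\cup P^n_k$ and $\pi$. Then $m\le n-k+1$.
   Context: **Sorting networks.** A comparator is a triple $\langle i,j,l\rangle$ of wires $1\le i<j$ and a level $l\ge1$. Two comparators are compatible if their wire sets $\{i,j\}$ are disjoint or their levels are distinct. A comparator network of width $n$ and depth $d$ is a set $N$ of mutually compatible comparators with wires in $\{1,\dots,n\}$ and levels in $\{1,\dots,d\}$. On an input vector $(x_1,\dots,x_n)$ of comparable values, the network processes levels $l=1,\dots,d$ in order; at level $l$, for each comparator $\langle i,j,l\rangle\in N$, the values on wires $i,j$ are replaced by their minimum (on wire $i$) and maximum (on wire $j$), other values being kept. $N$ is a sorting network if for every input the output satisfies $y_1\le\dots\le y_n$. **Programs, nogoods, answer sets.** A signed literal is $\mathbf{T}x$ or $\mathbf{F}x$ for an atom $x$. A (partial) assignment $A$ is a consistent set of signed literals (not containing both $\mathbf{T}x$ and $\mathbf{F}x$) over the atoms of the program at hand. A nogood is a finite set of signed literals; a constraint $\Gamma$ is a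 set of nogoods. $A$ is in conflict with a nogood $\delta$ if $\delta\subseteq A$, and with $\Gamma$ if it is in conflict with some member of $\Gamma$. $A$ satisfies $\delta$ if for some $\mathbf{T}a\in\delta$ we have $\mathbf{F}a\in A$ or for some $\mathbf{F}a\in\delta$ we have $\mathbf{T}a\in A$; it satisfies $\Gamma$ if it satisfies all members. A program $P$ is a set of normal rules $a\leftarrow b_1,\dots,b_r,\mathrm{not}\,c_1,\dots,\mathrm{not}\,c_s$ and nogoods, with signature $\mathrm{At}(P)$ of atoms containing those occurring in $P$ (the signature of a union is the union of signatures); $\mathrm{head}(P)$ is the set of rule heads. An interpretation $I\subseteq\mathrm{At}(P)$ is identified with the total assignment making exactly the atoms in $I$ true; it satisfies a rule if it satisfies the nogood $\{\mathbf{F}a,\mathbf{T}b_1,\dots,\mathbf{T}b_r,\mathbf{F}c_1,\dots,\mathbf{F}c_s\}$, and satisfies $P$ if it satisfies all its rules and nogoods. The reduct $P^I$ contains $a\leftarrow b_1,\dots,b_r$ for each rule of $P$ with $\{c_1,\dots,c_s\}\cap I=\emptyset$. An answer set of $P$ is an interpretation $I\subseteq \mathrm{At}(P)$ that satisfies $P$ and is $\subseteq$-minimal among the interpretations $J$ that satisfy all rules of $P^I$ and $J\setminus\mathrm{head}(P)=I\setminus\mathrm{head}(P)$. A supported model of $P$ is an interpretation $I$ satisfying $P$ such that for each $a\in I$ there is a rule of $P$ with head $a$, $\{b_1,\dots,b_r\}\subseteq I$ and $\{c_1,\dots,c_s\}\cap I=\emptyset$. The supported model constraint $\Gamma_{\mathrm{supp}}(P)$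 is the set of nogoods $\{\mathbf{T}a\mid a\in I\}\cup\{\mathbf{F}a\mid a\in\mathrm{At}(P)\setminus I\}$ for all $I\subseteq\mathrm{At}(P)$ that are not supported models of $P$. **Translation $\mathrm{ASP}(N)$.** Its signature is the set of distinct atoms $\mathtt{x}_{il}$, $1\le i\le n$, $0\le l\le d$. For each comparator $\langle i,j,l\rangle\in N$ it contains the rules $\mathtt{x}_{il}\leftarrow\mathtt{x}_{i(l-1)},\mathtt{x}_{j(l-1)}$; $\ \mathtt{x}_{jl}\leftarrow\mathtt{x}_{i(l-1)}$; $\ \mathtt{x}_{jl}\leftarrow\mathtt{x}_{j(l-1)}$. For each wire $i$ and level $1\le l\le d$ such that no comparator at level $l$ is incident with $i$, it contains $\mathtt{x}_{il}\leftarrow\mathtt{x}_{i(l-1)}$. **Binomial program.** $P^n_k$ on the atoms $\mathtt{x}_{10},\dots,\mathtt{x}_{n0}$ consists of a choice rule on these atoms and a cardinality constraint requiring at least $k$ of them. Explicitly, it consists of the rules $t\leftarrow$ (a fact), $\mathtt{x}_{i0}\leftarrow\mathrm{not}\,\mathtt{x}'_{i},t$ and $\mathtt{x}'_{i}\leftarrow\mathrm{not}\,\mathtt{x}_{i0}$ for $1\le i\le n$, where $t,\mathtt{x}'_1,\dots,\mathtt{x}'_n$ are fresh auxiliary atoms, together with the nogoods $\{\mathbf{F}x\mid x\in X\}$ for all $X\subseteq\{\mathtt{x}_{10},\dots,\mathtt{x}_{n0}\}$ with $|X|=n-k+1$. Its signature consists of these atoms. **Propagators and call histories.** A propagator $\pi$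 for a constraint $\Gamma$ (denoted $\Gamma_\pi$) is a function from partial assignments $A$ in conflict with $\Gamma$ to nogoods $\pi(A)\in\Gamma$ in conflict with $A$. A propagator call history (PCH) for a program $P$ and $\pi$ is a sequence $A_1,\dots,A_m$ of partial assignments such that for all $1\le i\le m$, $A_i$ satisfies $\Gamma_{\mathrm{supp}}(P)$ and the nogoods $\pi(A_1),\dots,\pi(A_{i-1})$, and conflicts with $\Gamma_\pi$. When $P\cup\Gamma_\pi$ has no answer sets, a PCH $A_1,\dots,A_m$ is complete if $P\cup\{\pi(A_1),\dots,\pi(A_m)\}$ has no answer sets. -}

module Defs where

open import Algebra.Construct.NaturalChoice.Max as Max using ()
open import Algebra.Construct.NaturalChoice.Min as Min using ()
open import Data.Bool.Base using (Bool; T)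
open import Data.Fin.Base as Fin using (Fin)
open import Data.Fin.Subset as Subset using (Subset)
open import Data.List.Base using (List; []; _∷_; [_]; _++_; map; foldr; filter)
open import Data.List.Membership.Propositional as List using ()
open import Data.List.Membership.Propositional.Properties using (∈-map⁻)
open import Data.List.Relation.Binary.Disjoint.Propositional using (Disjoint)
open import Data.List.Relation.Unary.All using (All; []; _∷_; lookup)
open import Data.List.Relation.Unary.AllPairs using (AllPairs)
open import Data.List.Relation.Unary.Sorted.TotalOrder using (Sorted)
open import Data.Nat.Base using (ℕ; zero; suc; _+_; _∸_; _≤_)
open import Data.Nat.Properties using (_≟_; ≤-trans; m∸n≤m)
open import Data.Product.Base using (Σ-syntax; ∃-syntax; _×_; _,_)
open import Data.Sum.Base using (_⊎_; inj₁; inj₂)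
open import Data.Vec.Functional using (Vector; updateAt; toList)
open import Function.Base using (const)
open import Level using (0ℓ)
open import Relation.Binary.Bundles using (TotalOrder)
open import Relation.Binary.PropositionalEquality using (_≡_; _≢_; refl)
open import Relation.Nullary using (¬_)
open import Relation.Unary using (Pred; ∅; _∈_; _∉_; _⊆_; _≐_; _∪_; _∖_)

-- Wires 1, …, n are represented by Fin n.
record Comparator (n : ℕ) : Set where
  field
    lo hi   : Fin n
    lo<hi   : lo Fin.< hi
    level   : ℕ
    1≤level : 1 ≤ level

  wires : List (Fin n)
  wires = lo ∷ hi ∷ []

open Comparator public

Compatible : ∀ {n} → Comparator n → Comparator n → Set
Compatible c c′ = Disjoint (wires c) (wires c′) ⊎ level c ≢ level c′

-- No comparator is compatible with itself, so AllPairs also rules out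
-- repetitions: the list is a faithful representation of a set.
record Network (n d : ℕ) : Set where
  field
    comparators : List (Comparator n)
    level≤d     : All (λ c → level c ≤ d) comparators
    compatible  : AllPairs Compatible comparators

open Network public

module Run (O : TotalOrder 0ℓ 0ℓ 0ℓ) where
  open TotalOrder O using (Carrier)
  open Min O using (_⊓_)
  open Max O using (_⊔_)

  compareExchange : ∀ {n} → Comparator n → Vector Carrier n → Vector Carrier n
  compareExchange c v =
    updateAt (updateAt v (lo c) (const (v (lo c) ⊓ v (hi c))))
             (hi c) (const (v (lo c) ⊔ v (hi c)))

  -- Comparators of one level act on disjoint pairs of wires, so the order
  -- in which they are applied is immaterial.
  runLevel : ∀ {n d} → Network n d → ℕ → Vector Carrier n → Vector Carrier n
  runLevel N l v =
    foldr compareExchange v (filter (λ c → level c ≟ l) (comparators N))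

  runUpTo : ∀ {n d} → Network n d → ℕ → Vector Carrier n → Vector Carrier n
  runUpTo N zero    v = v
  runUpTo N (suc l) v = runLevel N (suc l) (runUpTo N l v)

  run : ∀ {n d} → Network n d → Vector Carrier n → Vector Carrier n
  run {d = d} N = runUpTo N d

IsSortingNetwork : ∀ {n d} → Network n d → Set₁
IsSortingNetwork {n} N =
  (O : TotalOrder 0ℓ 0ℓ 0ℓ) (v : Vector (TotalOrder.Carrier O) n) →
  Sorted O (toList (Run.run O N v))

data Literal (Atom : Set) : Set where
  𝐓 𝐅 : Atom → Literal Atom

atom : ∀ {Atom} → Literal Atom → Atom
atom (𝐓 a) = a
atom (𝐅 a) = a

-- Assignments and interpretations are sets with decidable membership,
-- given by characteristic functions.
⟦_⟧ : {X : Set} → (X → Bool) → Pred X 0ℓ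
⟦ S ⟧ x = T (S x)

-- A nogood is a finite set of literals, given by a list; order and
-- repetitions are irrelevant.
Nogood : Set → Set
Nogood Atom = List (Literal Atom)

elements : {X : Set} → List X → Pred X 0ℓ
elements xs x = x List.∈ xs

Constraint : Set → Set₁
Constraint Atom = Pred (Nogood Atom) 0ℓ

module _ {Atom : Set} where

  record Assignment (At : Pred Atom 0ℓ) : Set where
    field
      literals   : Literal Atom → Bool
      over       : ∀ {ℓ} → ℓ ∈ ⟦ literals ⟧ → atom ℓ ∈ At
      consistent : ∀ a → ¬ (𝐓 a ∈ ⟦ literals ⟧ × 𝐅 a ∈ ⟦ literals ⟧)

  open Assignment public

  ConflictsWith : Pred (Literal Atom) 0ℓ → Nogood Atom → Set
  ConflictsWith A δ = elements δ ⊆ A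

  ConflictsWithConstraint : Pred (Literal Atom) 0ℓ → Constraint Atom → Set
  ConflictsWithConstraint A Γ = ∃[ δ ] (δ ∈ Γ × ConflictsWith A δ)

  Satisfies : Pred (Literal Atom) 0ℓ → Nogood Atom → Set
  Satisfies A δ = (∃[ a ] (𝐓 a List.∈ δ × 𝐅 a ∈ A))
                ⊎ (∃[ a ] (𝐅 a List.∈ δ × 𝐓 a ∈ A))

  SatisfiesConstraint : Pred (Literal Atom) 0ℓ → Constraint Atom → Set
  SatisfiesConstraint A Γ = ∀ δ → δ ∈ Γ → Satisfies A δ

record Rule (Atom : Set) : Set where
  constructor _←_not_
  field
    head    : Atom
    pos neg : List Atom

  ruleAtoms : List Atom
  ruleAtoms = head ∷ pos ++ neg

open Rule public

record Program (Atom : Set) : Set₁ where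
  field
    rules        : Pred (Rule Atom) 0ℓ
    nogoods      : Constraint Atom
    At           : Pred Atom 0ℓ
    rules-over   : ∀ r → r ∈ rules → elements (ruleAtoms r) ⊆ At
    nogoods-over : ∀ δ → δ ∈ nogoods → elements (map atom δ) ⊆ At

open Program public

module _ {Atom : Set} where

  heads : Program Atom → Pred Atom 0ℓ
  heads P a = ∃[ r ] (r ∈ rules P × head r ≡ a)

  infixl 6 _∪ᴾ_

  _∪ᴾ_ : Program Atom → Program Atom → Program Atom
  P ∪ᴾ Q = record
    { rules        = rules P ∪ rules Q
    ; nogoods      = nogoods P ∪ nogoods Q
    ; At           = At P ∪ At Q
    ; rules-over   = λ where
        r (inj₁ r∈P) a∈r → inj₁ (rules-over P r r∈P a∈r)
        r (inj₂ r∈Q) a∈r → inj₂ (rules-over Q r r∈Q a∈r)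
    ; nogoods-over = λ where
        δ (inj₁ δ∈P) a∈δ → inj₁ (nogoods-over P δ δ∈P a∈δ)
        δ (inj₂ δ∈Q) a∈δ → inj₂ (nogoods-over Q δ δ∈Q a∈δ)
    }

  fromConstraint : Constraint Atom → Program Atom
  fromConstraint Γ = record
    { rules        = ∅
    ; nogoods      = Γ
    ; At           = λ a → ∃[ δ ] (δ ∈ Γ × a List.∈ map atom δ)
    ; rules-over   = λ _ ()
    ; nogoods-over = λ δ δ∈Γ a∈δ → δ , δ∈Γ , a∈δ
    }

  record Interpretation (P : Program Atom) : Set where
    field
      trueAtoms : Atom → Bool
      ⊆At       : ⟦ trueAtoms ⟧ ⊆ At P

    true : Pred Atom 0ℓ
    true = ⟦ trueAtoms ⟧

    total : Pred (Literal Atom) 0ℓ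
    total (𝐓 a) = a ∈ true
    total (𝐅 a) = a ∈ At P ∖ true

  open Interpretation public

  module _ {P : Program Atom} where

    SatisfiesRule : Interpretation P → Rule Atom → Set
    SatisfiesRule I r =
      Satisfies (total I) (𝐅 (head r) ∷ map 𝐓 (pos r) ++ map 𝐅 (neg r))

    SatisfiesRules : Interpretation P → Pred (Rule Atom) 0ℓ → Set
    SatisfiesRules I R = ∀ r → r ∈ R → SatisfiesRule I r

    IsModel : Interpretation P → Set
    IsModel I = SatisfiesRules I (rules P)
              × SatisfiesConstraint (total I) (nogoods P)

    reduct : Interpretation P → Pred (Rule Atom) 0ℓ
    reduct I r′ = ∃[ r ] (r ∈ rules P × All (_∉ true I) (neg r)
                          × r′ ≡ (head r ← pos r not []))

    ReductCandidate : Interpretation P → Interpretation P → Set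
    ReductCandidate I J = SatisfiesRules J (reduct I)
                        × (true J ∖ heads P) ≐ (true I ∖ heads P)

    IsAnswerSet : Interpretation P → Set
    IsAnswerSet I = IsModel I
                  × ReductCandidate I I
                  × (∀ J → ReductCandidate I J → true J ⊆ true I → true I ⊆ true J)

    IsSupportedModel : Interpretation P → Set
    IsSupportedModel I =
      IsModel I
      × (∀ a → a ∈ true I →
         ∃[ r ] (r ∈ rules P × head r ≡ a
                 × All (_∈ true I) (pos r) × All (_∉ true I) (neg r)))

  NoAnswerSets : Program Atom → Set
  NoAnswerSets P = ¬ (∃[ I ] IsAnswerSet {P} I)

  Γsupp : Program Atom → Constraint Atom
  Γsupp P δ = Σ[ I ∈ Interpretation P ]
                (¬ IsSupportedModel I × elements δ ≐ total I)

  record Propagator (At : Pred Atom 0ℓ) (Γ : Constraint Atom) : Set where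
    field
      explain  : (A : Assignment At) →
                 ConflictsWithConstraint ⟦ literals A ⟧ Γ → Nogood Atom
      explain∈ : ∀ A c → explain A c ∈ Γ
      conflict : ∀ A c → ConflictsWith ⟦ literals A ⟧ (explain A c)
      -- The nogood depends on A only as a set of literals, and not on the
      -- evidence that A is in conflict.
      cong     : ∀ A B c c′ → ⟦ literals A ⟧ ≐ ⟦ literals B ⟧ →
                 elements (explain A c) ≐ elements (explain B c′)

  open Propagator public

  record PCH (P : Program Atom) {Γ : Constraint Atom} (π : Propagator (At P) Γ)
             {m : ℕ} (A : Vector (Assignment (At P)) m) : Set where
    field
      conflicts : ∀ i → ConflictsWithConstraint ⟦ literals (A i) ⟧ Γ
      satΓsupp  : ∀ i → SatisfiesConstraint ⟦ literals (A i) ⟧ (Γsupp P)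
      satPrev   : ∀ i j → j Fin.< i →
                  Satisfies ⟦ literals (A i) ⟧ (explain π (A j) (conflicts j))

    explanations : Constraint Atom
    explanations δ = ∃[ i ] δ ≡ explain π (A i) (conflicts i)

  open PCH public

  record CompletePCH (P : Program Atom) {Γ : Constraint Atom}
                     (π : Propagator (At P) Γ)
                     {m : ℕ} (A : Vector (Assignment (At P)) m) : Set where
    field
      pch          : PCH P π A
      unsolvable   : NoAnswerSets (P ∪ᴾ fromConstraint Γ)
      completeness : NoAnswerSets (P ∪ᴾ fromConstraint (explanations pch))

-- x i l is x_{il}; x′ i and t are the auxiliary atoms of Pⁿₖ.
data ProgAtom (n : ℕ) : Set where
  x  : Fin n → ℕ → ProgAtom n
  t  : ProgAtom n
  x′ : Fin n → ProgAtom n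

data ASPRule {n d} (N : Network n d) : Pred (Rule (ProgAtom n)) 0ℓ where
  minimum : ∀ {c} → c List.∈ comparators N →
    ASPRule N (x (lo c) (level c)
                 ← x (lo c) (level c ∸ 1) ∷ x (hi c) (level c ∸ 1) ∷ [] not [])
  maximum-lo : ∀ {c} → c List.∈ comparators N →
    ASPRule N (x (hi c) (level c) ← [ x (lo c) (level c ∸ 1) ] not [])
  maximum-hi : ∀ {c} → c List.∈ comparators N →
    ASPRule N (x (hi c) (level c) ← [ x (hi c) (level c ∸ 1) ] not [])
  pass : ∀ {i l} → 1 ≤ l → l ≤ d →
    (∀ {c} → c List.∈ comparators N → level c ≡ l → ¬ i List.∈ wires c) →
    ASPRule N (x i l ← [ x i (l ∸ 1) ] not [])

data ASPAtom {n} (d : ℕ) : Pred (ProgAtom n) 0ℓ where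
  x∈ : ∀ {i l} → l ≤ d → ASPAtom d (x i l)

ASP : ∀ {n d} → Network n d → Program (ProgAtom n)
ASP {n} {d} N = record
  { rules        = ASPRule N
  ; nogoods      = ∅
  ; At           = ASPAtom d
  ; rules-over   = λ r r∈ → lookup (over-r r∈)
  ; nogoods-over = λ _ ()
  }
  where
  now : ∀ {l i} → l ≤ d → ASPAtom {n} d (x i l)
  now = x∈

  prev : ∀ {l i} → l ≤ d → ASPAtom {n} d (x i (l ∸ 1))
  prev {l} l≤d = x∈ (≤-trans (m∸n≤m l 1) l≤d)

  over-r : ∀ {r} → ASPRule N r → All (ASPAtom d) (ruleAtoms r)
  over-r (minimum c∈)    = let l≤d = lookup (level≤d N) c∈ in now l≤d ∷ prev l≤d ∷ prev l≤d ∷ []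
  over-r (maximum-lo c∈) = let l≤d = lookup (level≤d N) c∈ in now l≤d ∷ prev l≤d ∷ []
  over-r (maximum-hi c∈) = let l≤d = lookup (level≤d N) c∈ in now l≤d ∷ prev l≤d ∷ []
  over-r (pass _ l≤d _)  = now l≤d ∷ prev l≤d ∷ []

data BinomialRule {n} : Pred (Rule (ProgAtom n)) 0ℓ where
  fact : BinomialRule (t ← [] not [])
  pick : ∀ i → BinomialRule (x i 0 ← [ t ] not [ x′ i ])
  drop : ∀ i → BinomialRule (x′ i ← [] not [ x i 0 ])

data BinomialAtom {n} : Pred (ProgAtom n) 0ℓ where
  x∈  : ∀ i → BinomialAtom (x i 0)
  t∈  : BinomialAtom t
  x′∈ : ∀ i → BinomialAtom (x′ i)

-- The set { sign x_{il} ∣ i ∈ W }; a set X of atoms of level l is given by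
-- its set W of wires.
literalsAt : ∀ {n} → (ProgAtom n → Literal (ProgAtom n)) → ℕ →
             Subset n → Pred (Literal (ProgAtom n)) 0ℓ
literalsAt sign l W ℓ = ∃[ i ] (i Subset.∈ W × ℓ ≡ sign (x i l))

Binomial : (n k : ℕ) → Program (ProgAtom n)
Binomial n k = record
  { rules        = BinomialRule
  ; nogoods      = Γ
  ; At           = BinomialAtom
  ; rules-over   = λ r r∈ → lookup (over-r r∈)
  ; nogoods-over = over-δ
  }
  where
  Γ : Constraint (ProgAtom n)
  Γ δ = Σ[ W ∈ Subset n ] (Subset.∣ W ∣ ≡ n ∸ k + 1
                           × elements δ ≐ literalsAt 𝐅 0 W)

  over-r : ∀ {r} → BinomialRule r → All BinomialAtom (ruleAtoms r)
  over-r fact     = t∈ ∷ []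
  over-r (pick i) = x∈ i ∷ t∈ ∷ x′∈ i ∷ []
  over-r (drop i) = x′∈ i ∷ x∈ i ∷ []

  over-δ : ∀ δ → δ ∈ Γ → elements (map atom δ) ⊆ BinomialAtom
  over-δ δ (W , _ , δ⊆ , _) a∈ with ∈-map⁻ atom a∈
  ... | ℓ , ℓ∈δ , refl with δ⊆ ℓ∈δ
  ...   | i , _ , refl = x∈ i

OutputConstraint : (n k d : ℕ) → Constraint (ProgAtom n)
OutputConstraint n k d δ =
  Σ[ W ∈ Subset n ] (Subset.∣ W ∣ ≡ k × elements δ ≐ literalsAt 𝐓 d W)

{-# OPTIONS --safe #-}
-- A propagator call has to satisfy the supported model constraint, so the true
-- atoms of its assignment form a supported model of ASP(N) ∪ Pⁿₖ.  In such a
-- model the atoms x_{il} carry the values that N computes at level l from the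
-- Boolean inputs x_{i0}; as N sorts, the true output wires are upward closed.
-- Explaining a call by a k-set W of true outputs, a later call must have some
-- output of W, and hence also the least wire of W, false; so the least wires of
-- the explanations strictly increase.  The least wire of a k-set takes only
-- n − k + 1 values.  For k = 0 the only explanation is the empty nogood, which
-- no later call can satisfy.
module Submission where

open import Defs

open import Algebra.Construct.NaturalChoice.Max as Max using ()
open import Algebra.Construct.NaturalChoice.Min as Min using ()
open import Data.Bool.Base using (Bool; T; if_then_else_; _∧_; _∨_)
import Data.Bool.Base as Bool
open import Data.Bool.Properties using (≤-totalOrder; T-∧; T-∨; T?)
open import Data.Fin.Base as Fin using (Fin; zero; suc; toℕ; fromℕ<)
import Data.Fin.Properties as Fin
open import Data.Fin.Subset as Subset using (Subset; inside; outside; ∣_∣)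
open import Data.Fin.Subset.Properties using (∣p∣≤n)
open import Data.List.Base
  using (List; []; _∷_; _++_; map; filter; foldr; tabulate; upTo; allFin; cartesianProductWith)
open import Data.List.Membership.DecPropositional using () renaming (_∈?_ to mem?)
open import Data.List.Membership.Propositional as List using (find; lose)
open import Data.List.Membership.Propositional.Properties
  using (∈-map⁺; ∈-map⁻; ∈-++⁺ˡ; ∈-++⁺ʳ; ∈-++⁻; ∈-tabulate⁺; ∈-tabulate⁻; ∈-allFin;
         ∈-upTo⁺; ∈-upTo⁻; ∈-cartesianProductWith⁺; ∈-cartesianProductWith⁻; ∈-filter⁺; ∈-filter⁻)
open import Data.List.Relation.Binary.Disjoint.Propositional using (Disjoint)
open import Data.List.Relation.Unary.All as All using (All; []; _∷_)
import Data.List.Relation.Unary.All.Properties as All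
open import Data.List.Relation.Unary.AllPairs as AllPairs using (AllPairs; []; _∷_)
import Data.List.Relation.Unary.AllPairs.Properties as AllPairs
open import Data.List.Relation.Unary.Any using (here; there; any?)
open import Data.List.Relation.Unary.Sorted.TotalOrder using (Sorted)
open import Data.List.Relation.Unary.Sorted.TotalOrder.Properties using (Sorted⇒AllPairs)
open import Data.Nat.Base as ℕ using (ℕ; zero; suc; _+_; _∸_; _≤_; z≤n; s≤s)
import Data.Nat.Properties as ℕ
open import Data.Product.Base using (∃-syntax; _×_; _,_; proj₁; proj₂)
open import Data.Sum.Base using (_⊎_; inj₁; inj₂)
open import Data.Vec.Base using (_∷_; here; there)
open import Data.Vec.Functional using (Vector; toList)
open import Data.Vec.Functional.Properties using (updateAt-updates; updateAt-minimal)
open import Function.Base using (_∘_)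
open import Function.Bundles using (module Equivalence)
open import Level using (0ℓ)
open import Relation.Binary.Bundles using (TotalOrder)
open import Relation.Binary.Definitions using (tri<; tri≈; tri>)
open import Relation.Binary.PropositionalEquality
  using (_≡_; _≢_; refl; sym; trans; cong₂; subst; subst₂)
open import Relation.Nullary using (¬_; yes; no; contradiction)
open import Relation.Nullary.Decidable using (_×-dec_; decidable-stable)
open import Relation.Unary using (_∈_; _∉_; _⊆_; _≐_)

open Equivalence using (to; from)

-- Comparators meeting a given wire at a given level.

module _ {n d} (N : Network n d) where

  -- Distinct members of the list are compatible, so on one level their wires are disjoint. This
  -- later identifies the comparator of a supporting rule.
  share-wire⇒≡ : ∀ {c c′ i} → c List.∈ comparators N → c′ List.∈ comparators N →
                 level c ≡ level c′ → i List.∈ wires c → i List.∈ wires c′ → c ≡ c′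
  share-wire⇒≡ {i = i} = go (compatible N)
    where
    clash : ∀ {c c′} → Compatible c c′ → level c ≡ level c′ →
            i List.∈ wires c → ¬ i List.∈ wires c′
    clash (inj₁ disjoint) _  i∈c i∈c′ = disjoint (i∈c , i∈c′)
    clash (inj₂ l≢)       l≡ _   _    = l≢ l≡

    go : ∀ {cs c c′} → AllPairs Compatible cs → c List.∈ cs → c′ List.∈ cs →
         level c ≡ level c′ → i List.∈ wires c → i List.∈ wires c′ → c ≡ c′
    go _        (here refl) (here refl)  _  _   _    = refl
    go {c = c} {c′} (p ∷ _)  (here refl) (there c′∈)  l≡ i∈c i∈c′ =
      contradiction i∈c′ (clash {c} {c′} (All.lookup p c′∈) l≡ i∈c)
    go {c = c} {c′} (p ∷ _)  (there c∈)  (here refl)  l≡ i∈c i∈c′ =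
      contradiction i∈c (clash {c′} {c} (All.lookup p c∈) (sym l≡) i∈c′)
    go (_ ∷ ps) (there c∈)  (there c′∈)  l≡ i∈c i∈c′ = go ps c∈ c′∈ l≡ i∈c i∈c′

  atLevel : ℕ → List (Comparator n)
  atLevel l = filter (λ c → level c ℕ.≟ l) (comparators N)

  atLevel-disjoint : ∀ l → AllPairs (λ c c′ → Disjoint (wires c) (wires c′)) (atLevel l)
  atLevel-disjoint l =
    go (All.all-filter (λ c → level c ℕ.≟ l) (comparators N))
       (AllPairs.filter⁺ (λ c → level c ℕ.≟ l) (compatible N))
    where
    disjoint : ∀ {c c′} → level c ≡ l → level c′ ≡ l × Compatible c c′ →
               Disjoint (wires c) (wires c′)
    disjoint _  (_   , inj₁ dis) = dis
    disjoint l≡ (l′≡ , inj₂ l≢)  = contradiction (trans l≡ (sym l′≡)) l≢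

    go : ∀ {cs} → All (λ c → level c ≡ l) cs → AllPairs Compatible cs →
         AllPairs (λ c c′ → Disjoint (wires c) (wires c′)) cs
    go []         []       = []
    go {c ∷ _} (l≡ ∷ l≡s) (p ∷ ps) =
      All.map (λ {c′} → disjoint {c} {c′} l≡) (All.zip (l≡s , p)) ∷ go l≡s ps

  -- Level and wire are indices, so that a case split replaces them by the level and the wire of the
  -- comparator found.
  data Incidence : ℕ → Fin n → Set where
    lower : ∀ {c} → c List.∈ comparators N → Incidence (level c) (lo c)
    upper : ∀ {c} → c List.∈ comparators N → Incidence (level c) (hi c)
    idle  : ∀ {l i} →
            (∀ {c} → c List.∈ comparators N → level c ≡ l → ¬ i List.∈ wires c) →
            Incidence l i

  incidence : ∀ l i → Incidence l i
  incidence l i with any? (λ c → level c ℕ.≟ l ×-dec mem? Fin._≟_ i (wires c)) (comparators N)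
  ... | no  none = idle λ c∈ l≡ i∈ → none (lose c∈ (l≡ , i∈))
  ... | yes some with find some
  ...   | _ , c∈ , refl , here refl         = lower c∈
  ...   | _ , c∈ , refl , there (here refl) = upper c∈

lo≢hi : ∀ {n} (c : Comparator n) → lo c ≢ hi c
lo≢hi c = Fin.<⇒≢ (lo<hi c)

-- The effect of one level, wire by wire, over an arbitrary total order.

module _ (O : TotalOrder 0ℓ 0ℓ 0ℓ) where
  open TotalOrder O using (Carrier) renaming (_≤_ to _≼_; refl to ≼-refl)
  open Min O using (_⊓_)
  open Max O using (_⊔_)
  open Run O

  module _ {n} (c : Comparator n) (v : Vector Carrier n) where

    compareExchange-lo : compareExchange c v (lo c) ≡ v (lo c) ⊓ v (hi c)
    compareExchange-lo =
      trans (updateAt-minimal (lo c) (hi c) _ (lo≢hi c)) (updateAt-updates (lo c) v)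

    compareExchange-hi : compareExchange c v (hi c) ≡ v (lo c) ⊔ v (hi c)
    compareExchange-hi = updateAt-updates (hi c) _

    compareExchange-idle : ∀ {i} → ¬ i List.∈ wires c → compareExchange c v i ≡ v i
    compareExchange-idle {i} i∉ =
      trans (updateAt-minimal i (hi c) _ (λ i≡ → i∉ (there (here i≡))))
            (updateAt-minimal i (lo c) v (i∉ ∘ here))

  module _ {n} (v : Vector Carrier n) where

    exchangeAll : List (Comparator n) → Vector Carrier n
    exchangeAll = foldr compareExchange v

    exchangeAll-idle : ∀ {i} cs → (∀ {c} → c List.∈ cs → ¬ i List.∈ wires c) →
                       exchangeAll cs i ≡ v i
    exchangeAll-idle []       _    = refl
    exchangeAll-idle (c ∷ cs) none =
      trans (compareExchange-idle c _ (none (here refl)))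
            (exchangeAll-idle cs (none ∘ there))

    -- `foldr` applies the head last. By disjointness, the comparators applied before `c` leave its
    -- inputs as they are in `v`, and those applied after it leave its outputs alone.
    exchangeAll-∈ : ∀ {cs c} → AllPairs (λ c c′ → Disjoint (wires c) (wires c′)) cs →
                    c List.∈ cs →
                    exchangeAll cs (lo c) ≡ v (lo c) ⊓ v (hi c) ×
                    exchangeAll cs (hi c) ≡ v (lo c) ⊔ v (hi c)
    exchangeAll-∈ {c ∷ cs} (dis ∷ _) (here refl) =
      trans (compareExchange-lo c _) (cong₂ _⊓_ at-lo at-hi) ,
      trans (compareExchange-hi c _) (cong₂ _⊔_ at-lo at-hi)
      where
      untouched : ∀ {i} → i List.∈ wires c → exchangeAll cs i ≡ v i
      untouched i∈ = exchangeAll-idle cs λ c′∈ i∈′ → All.lookup dis c′∈ (i∈ , i∈′)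

      at-lo = untouched (here refl)
      at-hi = untouched (there (here refl))
    exchangeAll-∈ {c′ ∷ cs} {c} (dis ∷ diss) (there c∈) with exchangeAll-∈ diss c∈
    ... | lo≡ , hi≡ =
      trans (compareExchange-idle c′ _ (untouched (here refl))) lo≡ ,
      trans (compareExchange-idle c′ _ (untouched (there (here refl)))) hi≡
      where
      untouched : ∀ {i} → i List.∈ wires c → ¬ i List.∈ wires c′
      untouched i∈ i∈′ = All.lookup dis c∈ (i∈′ , i∈)

  module _ {n d} (N : Network n d) (v : Vector Carrier n) where

    runLevel-∈ : ∀ {c} → c List.∈ comparators N →
                 runLevel N (level c) v (lo c) ≡ v (lo c) ⊓ v (hi c) ×
                 runLevel N (level c) v (hi c) ≡ v (lo c) ⊔ v (hi c)
    runLevel-∈ {c} c∈ =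
      exchangeAll-∈ v (atLevel-disjoint N (level c)) (∈-filter⁺ (λ c′ → level c′ ℕ.≟ level c) c∈ refl)

    runLevel-idle : ∀ {l i} →
      (∀ {c} → c List.∈ comparators N → level c ≡ l → ¬ i List.∈ wires c) →
      runLevel N l v i ≡ v i
    runLevel-idle {l} none = exchangeAll-idle v (atLevel N l) λ c∈ →
      let c∈N , l≡ = ∈-filter⁻ (λ c → level c ℕ.≟ l) c∈ in none c∈N l≡

  Sorted-toList⇒mono : ∀ {n} (v : Vector Carrier n) → Sorted O (toList v) →
                       ∀ {i j} → i Fin.≤ j → v i ≼ v j
  Sorted-toList⇒mono v sorted = go v (Sorted⇒AllPairs O sorted)
    where
    go : ∀ {n} (v : Vector Carrier n) → AllPairs _≼_ (toList v) →
         ∀ {i j} → i Fin.≤ j → v i ≼ v j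
    go v _        {zero}  {zero}  _         = ≼-refl
    go v (p ∷ _)  {zero}  {suc j} _         = All.tabulate⁻ p j
    go v (_ ∷ ps) {suc i} {suc j} (s≤s i≤j) = go (v ∘ suc) ps i≤j

-- Booleans as a total order.

T-≤ : ∀ {a b} → a Bool.≤ b → T a → T b
T-≤ Bool.b≤b Ta = Ta

T-cong⁻ : ∀ {a b} → (T a → T b) → (T b → T a) → a ≡ b
T-cong⁻ {Bool.false} {Bool.false} _ _ = refl
T-cong⁻ {Bool.false} {Bool.true}  _ g = contradiction _ g
T-cong⁻ {Bool.true}  {Bool.false} f _ = contradiction _ f
T-cong⁻ {Bool.true}  {Bool.true}  _ _ = refl

open Min ≤-totalOrder using () renaming (_⊓_ to _⊓ᴮ_)
open Max ≤-totalOrder using () renaming (_⊔_ to _⊔ᴮ_)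

∧≡⊓ : ∀ a b → a ∧ b ≡ a ⊓ᴮ b
∧≡⊓ Bool.false Bool.false = refl
∧≡⊓ Bool.false Bool.true  = refl
∧≡⊓ Bool.true  Bool.false = refl
∧≡⊓ Bool.true  Bool.true  = refl

∨≡⊔ : ∀ a b → a ∨ b ≡ a ⊔ᴮ b
∨≡⊔ Bool.false Bool.false = refl
∨≡⊔ Bool.false Bool.true  = refl
∨≡⊔ Bool.true  Bool.false = refl
∨≡⊔ Bool.true  Bool.true  = refl

-- Interpretations and the supported model constraint.

module _ {Atom : Set} {P : Program Atom} (I : Interpretation P) where

  -- Satisfying the nogood of the rule means making one of its literals false. A true body excludes
  -- all literals but `𝐅 a`; the absurd cases are mismatches of sign.
  fire : ∀ {a ps ns} → SatisfiesRule I (a ← ps not ns) →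
         All (_∈ true I) ps → All (_∉ true I) ns → a ∈ true I
  fire {a} {ps} {ns} (inj₁ (b , there b∈ , _ , b∉I)) ps∈ ns∉ with ∈-++⁻ (map 𝐓 ps) b∈
  ... | inj₁ b∈ps with ∈-map⁻ 𝐓 b∈ps
  ...   | _ , b∈ , refl = contradiction (All.lookup ps∈ b∈) b∉I
  fire {a} {ps} {ns} (inj₁ (b , there b∈ , _ , b∉I)) ps∈ ns∉ | inj₂ b∈ns with ∈-map⁻ 𝐅 b∈ns
  ...   | _ , _ , ()
  fire (inj₂ (b , here refl , b∈I)) _ _ = b∈I
  fire {a} {ps} {ns} (inj₂ (b , there b∈ , b∈I)) ps∈ ns∉ with ∈-++⁻ (map 𝐓 ps) b∈
  ... | inj₁ b∈ps with ∈-map⁻ 𝐓 b∈ps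
  ...   | _ , _ , ()
  fire {a} {ps} {ns} (inj₂ (b , there b∈ , b∈I)) ps∈ ns∉ | inj₂ b∈ns with ∈-map⁻ 𝐅 b∈ns
  ...   | _ , b∈ , refl = contradiction b∈I (All.lookup ns∉ b∈)

module _ {Atom : Set} {P : Program Atom} (A : Assignment (At P)) where

  -- Atoms that `A` leaves unassigned become false here.
  trueInterpretation : Interpretation P
  trueInterpretation = record
    { trueAtoms = literals A ∘ 𝐓
    ; ⊆At       = over A
    }

  -- The total assignment of the true atoms of A contains no literal
  -- opposite to one of A, so A does not satisfy it as a nogood.
  ¬¬supported : ∀ δ → elements δ ≐ total trueInterpretation →
                SatisfiesConstraint ⟦ literals A ⟧ (Γsupp P) →
                ¬ ¬ IsSupportedModel trueInterpretation
  ¬¬supported δ δ≐@(δ⊆ , _) sat ¬sup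
    with sat δ (trueInterpretation , ¬sup , δ≐)
  ... | inj₁ (a , Ta∈δ , Fa∈A) = consistent A a (δ⊆ Ta∈δ , Fa∈A)
  ... | inj₂ (a , Fa∈δ , Ta∈A) = proj₂ (δ⊆ Fa∈δ) Ta∈A

module _ {Atom : Set} {P : Program Atom} (I : Interpretation P)
         (atoms : List Atom) (atoms≐ : elements atoms ≐ At P) where

  -- Nogoods are finite, so `Γsupp P` contains a nogood against `I` only if the atoms of `P` can be
  -- listed. This is the list that `¬¬supported` asks for.
  totalNogood : Nogood Atom
  totalNogood = map (λ a → if trueAtoms I a then 𝐓 a else 𝐅 a) atoms

  totalNogood≐ : elements totalNogood ≐ total I
  totalNogood≐ = ⇒ , λ {ℓ} → ⇐ ℓ
    where
    sound : ∀ a → a ∈ At P → total I (if trueAtoms I a then 𝐓 a else 𝐅 a)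
    sound a a∈ with trueAtoms I a in eq
    ... | Bool.true  = subst T (sym eq) _
    ... | Bool.false = a∈ , subst T eq

    ⇒ : elements totalNogood ⊆ total I
    ⇒ ℓ∈ with ∈-map⁻ _ ℓ∈
    ... | a , a∈ , refl = sound a (proj₁ atoms≐ a∈)

    listed : ∀ {ℓ} a → a ∈ At P → ℓ ≡ (if trueAtoms I a then 𝐓 a else 𝐅 a) →
             ℓ List.∈ totalNogood
    listed a a∈ refl = ∈-map⁺ _ (proj₂ atoms≐ a∈)

    ⇐ : ∀ ℓ → total I ℓ → ℓ List.∈ totalNogood
    ⇐ (𝐓 a) a∈I = listed a (⊆At I a∈I) (𝐓≡ (trueAtoms I a) a∈I)
      where
      𝐓≡ : ∀ b → T b → 𝐓 a ≡ (if b then 𝐓 a else 𝐅 a)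
      𝐓≡ Bool.true _ = refl
    ⇐ (𝐅 a) (a∈ , a∉I) = listed a a∈ (𝐅≡ (trueAtoms I a) a∉I)
      where
      𝐅≡ : ∀ b → ¬ T b → 𝐅 a ≡ (if b then 𝐓 a else 𝐅 a)
      𝐅≡ Bool.true  ¬b = contradiction _ ¬b
      𝐅≡ Bool.false _  = refl

-- Finiteness of the signature.

module _ (n d k : ℕ) (N : Network n d) where

  wireAtoms : List (ProgAtom n)
  wireAtoms = cartesianProductWith x (allFin n) (upTo (suc d))

  allAtoms : List (ProgAtom n)
  allAtoms = t ∷ wireAtoms ++ tabulate x′

  allAtoms≐ : elements allAtoms ≐ At (ASP N ∪ᴾ Binomial n k)
  allAtoms≐ = ⇒ , ⇐
    where
    ⇒ : elements allAtoms ⊆ At (ASP N ∪ᴾ Binomial n k)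
    ⇒ (here refl) = inj₂ t∈
    ⇒ (there a∈) with ∈-++⁻ wireAtoms a∈
    ... | inj₁ xil∈ with ∈-cartesianProductWith⁻ x (allFin n) (upTo (suc d)) xil∈
    ...   | _ , _ , _ , l∈ , refl = inj₁ (x∈ (ℕ.≤-pred (∈-upTo⁻ l∈)))
    ⇒ (there a∈) | inj₂ x′∈tab with ∈-tabulate⁻ x′∈tab
    ...   | i , refl = inj₂ (x′∈ i)

    listed : ∀ {i l} → l ≤ d → x i l List.∈ allAtoms
    listed l≤d = there (∈-++⁺ˡ (∈-cartesianProductWith⁺ x (∈-allFin _) (∈-upTo⁺ (s≤s l≤d))))

    ⇐ : At (ASP N ∪ᴾ Binomial n k) ⊆ elements allAtoms
    ⇐ (inj₁ (x∈ l≤d)) = listed l≤d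
    -- The inputs of the binomial program are the wire atoms of level 0, on which the two signatures
    -- overlap.
    ⇐ (inj₂ (x∈ i))   = listed z≤n
    ⇐ (inj₂ t∈)       = here refl
    ⇐ (inj₂ (x′∈ i))  = there (∈-++⁺ʳ wireAtoms (∈-tabulate⁺ i))

x-injective : ∀ {n} {i j : Fin n} {l m} → x i l ≡ x j m → i ≡ j × l ≡ m
x-injective refl = refl , refl

-- Supported models simulate the network.

module _ {n d} (k : ℕ) (N : Network n d)
         (M : Interpretation (ASP N ∪ᴾ Binomial n k)) (sup : IsSupportedModel M) where

  value : ℕ → Vector Bool n
  value l i = trueAtoms M (x i l)

  holds : ∀ {a ps} → ASPRule N (a ← ps not []) → All (_∈ true M) ps → a ∈ true M
  holds r∈ ps∈ = fire M (proj₁ (proj₁ sup) _ (inj₁ r∈)) ps∈ []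

  -- The only binomial rules with a head of the form `x i l` are the `pick` rules, and these have
  -- level 0; above it, support comes from `ASP N`.
  support : ∀ {i l} → 1 ≤ l → x i l ∈ true M →
            ∃[ r ] (ASPRule N r × head r ≡ x i l × All (_∈ true M) (pos r))
  support 1≤l a∈ with proj₂ sup _ a∈
  ... | r , inj₁ r∈ , r≡ , ps∈ , _ = r , r∈ , r≡ , ps∈
  support () a∈ | _ , inj₂ (pick i) , refl , _ , _

  -- One direction fires the `minimum` rule. For the other, a supporting comparator rule must belong
  -- to `c`, which shares its level and wire. A maximum rule would then give `lo c ≡ hi c`, and
  -- `pass` needs a wire without comparator.
  value-lo : ∀ {c} → c List.∈ comparators N →
    value (level c) (lo c) ≡ value (level c ∸ 1) (lo c) ∧ value (level c ∸ 1) (hi c)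
  value-lo {c} c∈ = T-cong⁻ (⇒ ∘ support (1≤level c)) ⇐
    where
    ⇐ : T (value (level c ∸ 1) (lo c) ∧ value (level c ∸ 1) (hi c)) → T (value (level c) (lo c))
    ⇐ both = let p , q = to T-∧ both in holds (minimum c∈) (p ∷ q ∷ [])

    ⇒ : ∃[ r ] (ASPRule N r × head r ≡ x (lo c) (level c) × All (_∈ true M) (pos r)) →
        T (value (level c ∸ 1) (lo c) ∧ value (level c ∸ 1) (hi c))
    ⇒ (_ , minimum c′∈ , eq , p ∷ q ∷ []) with x-injective eq
    ... | i≡ , l≡ with share-wire⇒≡ N c∈ c′∈ (sym l≡) (here refl) (here (sym i≡))
    ...   | refl = from T-∧ (p , q)
    ⇒ (_ , maximum-lo c′∈ , eq , _) with x-injective eq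
    ... | i≡ , l≡ with share-wire⇒≡ N c∈ c′∈ (sym l≡) (here refl) (there (here (sym i≡)))
    ...   | refl = contradiction (sym i≡) (lo≢hi c)
    ⇒ (_ , maximum-hi c′∈ , eq , _) with x-injective eq
    ... | i≡ , l≡ with share-wire⇒≡ N c∈ c′∈ (sym l≡) (here refl) (there (here (sym i≡)))
    ...   | refl = contradiction (sym i≡) (lo≢hi c)
    ⇒ (_ , pass _ _ none , refl , _) = contradiction (here refl) (none c∈ refl)

  value-hi : ∀ {c} → c List.∈ comparators N →
    value (level c) (hi c) ≡ value (level c ∸ 1) (lo c) ∨ value (level c ∸ 1) (hi c)
  value-hi {c} c∈ = T-cong⁻ (⇒ ∘ support (1≤level c)) (⇐ ∘ to T-∨)
    where
    ⇐ : T (value (level c ∸ 1) (lo c)) ⊎ T (value (level c ∸ 1) (hi c)) → T (value (level c) (hi c))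
    ⇐ (inj₁ p) = holds (maximum-lo c∈) (p ∷ [])
    ⇐ (inj₂ q) = holds (maximum-hi c∈) (q ∷ [])

    ⇒ : ∃[ r ] (ASPRule N r × head r ≡ x (hi c) (level c) × All (_∈ true M) (pos r)) →
        T (value (level c ∸ 1) (lo c) ∨ value (level c ∸ 1) (hi c))
    ⇒ (_ , minimum c′∈ , eq , _) with x-injective eq
    ... | i≡ , l≡ with share-wire⇒≡ N c∈ c′∈ (sym l≡) (there (here refl)) (here (sym i≡))
    ...   | refl = contradiction i≡ (lo≢hi c)
    ⇒ (_ , maximum-lo c′∈ , eq , p ∷ []) with x-injective eq
    ... | i≡ , l≡ with share-wire⇒≡ N c∈ c′∈ (sym l≡) (there (here refl)) (there (here (sym i≡)))
    ...   | refl = from T-∨ (inj₁ p)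
    ⇒ (_ , maximum-hi c′∈ , eq , q ∷ []) with x-injective eq
    ... | i≡ , l≡ with share-wire⇒≡ N c∈ c′∈ (sym l≡) (there (here refl)) (there (here (sym i≡)))
    ...   | refl = from (T-∨ {value (level c ∸ 1) (lo c)}) (inj₂ q)
    ⇒ (_ , pass _ _ none , refl , _) = contradiction (there (here refl)) (none c∈ refl)

  value-idle : ∀ {l i} → 1 ≤ l → l ≤ d →
    (∀ {c} → c List.∈ comparators N → level c ≡ l → ¬ i List.∈ wires c) →
    value l i ≡ value (l ∸ 1) i
  value-idle {l} {i} 1≤l l≤d none =
    T-cong⁻ (⇒ ∘ support 1≤l) (λ p → holds (pass 1≤l l≤d none) (p ∷ []))
    where
    ⇒ : ∃[ r ] (ASPRule N r × head r ≡ x i l × All (_∈ true M) (pos r)) → T (value (l ∸ 1) i)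
    ⇒ (_ , minimum c∈    , refl , _)      = contradiction (here refl) (none c∈ refl)
    ⇒ (_ , maximum-lo c∈ , refl , _)      = contradiction (there (here refl)) (none c∈ refl)
    ⇒ (_ , maximum-hi c∈ , refl , _)      = contradiction (there (here refl)) (none c∈ refl)
    ⇒ (_ , pass _ _ _    , refl , p ∷ []) = p

  open Run ≤-totalOrder

  -- v is only pointwise equal to the previous level, for want of function
  -- extensionality.
  value-runLevel : ∀ {l i v} → 1 ≤ l → l ≤ d → (∀ j → value (l ∸ 1) j ≡ v j) →
                   Incidence N l i → value l i ≡ runLevel N l v i
  value-runLevel {v = v} _ _ ih (lower {c} c∈) =
    trans (value-lo c∈) (trans (∧≡⊓ (value _ (lo c)) (value _ (hi c)))
      (trans (cong₂ _⊓ᴮ_ (ih (lo c)) (ih (hi c))) (sym (proj₁ (runLevel-∈ ≤-totalOrder N v c∈)))))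
  value-runLevel {v = v} _ _ ih (upper {c} c∈) =
    trans (value-hi c∈) (trans (∨≡⊔ (value _ (lo c)) (value _ (hi c)))
      (trans (cong₂ _⊔ᴮ_ (ih (lo c)) (ih (hi c))) (sym (proj₂ (runLevel-∈ ≤-totalOrder N v c∈)))))
  value-runLevel {v = v} 1≤l l≤d ih (idle none) =
    trans (value-idle 1≤l l≤d none) (trans (ih _) (sym (runLevel-idle ≤-totalOrder N v none)))

  value-runUpTo : ∀ {l} → l ≤ d → ∀ i → value l i ≡ runUpTo N l (value 0) i
  value-runUpTo {zero}  _   _ = refl
  value-runUpTo {suc l} l<d i =
    value-runLevel (s≤s z≤n) l<d (value-runUpTo {l} (ℕ.<⇒≤ l<d)) (incidence N (suc l) i)

  -- The sorting property is applied to the Boolean inputs `value 0`, ordered by false below true.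
  outputs-upward-closed : IsSortingNetwork N → ∀ {i j} → i Fin.≤ j →
                          T (value d i) → T (value d j)
  outputs-upward-closed sorts {i} {j} i≤j p =
    subst T (sym (output j))
      (T-≤ (Sorted-toList⇒mono ≤-totalOrder _ (sorts ≤-totalOrder (value 0)) i≤j)
        (subst T (output i) p))
    where output = value-runUpTo ℕ.≤-refl

-- Least elements of subsets and counting.

least : ∀ {n k} (W : Subset n) → ∣ W ∣ ≡ suc k →
        ∃[ i ] (i Subset.∈ W × (∀ {j} → j Subset.∈ W → i Fin.≤ j) × toℕ i + suc k ≤ n)
-- The bound says that the wires from the least one on have room for all `suc k` elements. Here the
-- least wire is 0, and it remains that the rest of the set fits into `n` wires.
least {suc n} (inside ∷ W) refl = zero , here , (λ _ → z≤n) , s≤s (∣p∣≤n W)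
least {suc n} (outside ∷ W) eq with least W eq
... | i , i∈ , i≤ , bound = suc i , there i∈ , (λ where (there j∈) → s≤s (i≤ j∈)) , s≤s bound

strictMono⇒≤ : ∀ {m n} (f : Fin m → Fin n) → (∀ {i j} → i Fin.< j → f i Fin.< f j) → m ≤ n
strictMono⇒≤ f mono = Fin.injective⇒≤ {f = f} λ {i} {j} eq → injective i j eq
  where
  injective : ∀ i j → f i ≡ f j → i ≡ j
  injective i j eq with Fin.<-cmp i j
  ... | tri< i<j _ _ = contradiction eq (Fin.<⇒≢ (mono i<j))
  ... | tri≈ _ i≡j _ = i≡j
  ... | tri> _ _ j<i = contradiction (sym eq) (Fin.<⇒≢ (mono j<i))

∣W∣≡0⇒∉ : ∀ {n} {W : Subset n} {i} → ∣ W ∣ ≡ 0 → ¬ i Subset.∈ W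
∣W∣≡0⇒∉ {W = outside ∷ W} eq (there i∈) = ∣W∣≡0⇒∉ eq i∈

-- Calls and their explanations.

module _ {n k d : ℕ} (N : Network n d) (sorts : IsSortingNetwork N)
         (π : Propagator (At (ASP N ∪ᴾ Binomial n k)) (OutputConstraint n k d))
         {m : ℕ} {A : Vector (Assignment (At (ASP N ∪ᴾ Binomial n k))) m}
         (h : PCH (ASP N ∪ᴾ Binomial n k) π A) where

  explained : Fin m → Subset n
  explained i = proj₁ (explain∈ π (A i) (conflicts h i))

  ∣explained∣ : ∀ i → ∣ explained i ∣ ≡ k
  ∣explained∣ i = proj₁ (proj₂ (explain∈ π (A i) (conflicts h i)))

  explanation≐ : ∀ i → elements (explain π (A i) (conflicts h i)) ≐ literalsAt 𝐓 d (explained i)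
  explanation≐ i = proj₂ (proj₂ (explain∈ π (A i) (conflicts h i)))

  explained-true : ∀ i {w} → w Subset.∈ explained i → T (literals (A i) (𝐓 (x w d)))
  explained-true i w∈ =
    conflict π (A i) (conflicts h i) (proj₂ (explanation≐ i) (_ , w∈ , refl))

  true-upward : ∀ i {w w′} → w Fin.≤ w′ →
                T (literals (A i) (𝐓 (x w d))) → T (literals (A i) (𝐓 (x w′ d)))
  -- Supportedness is known only up to double negation. The goal is the truth of a Boolean and hence
  -- stable, so that suffices.
  true-upward i {w} {w′} w≤w′ p = decidable-stable (T? _) λ ¬q →
    ¬¬supported (A i) _
      (totalNogood≐ (trueInterpretation (A i)) (allAtoms n d k N) (allAtoms≐ n d k N))
      (satΓsupp h i)
      λ sup → ¬q (outputs-upward-closed k N (trueInterpretation (A i)) sup sorts w≤w′ p)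

  -- The explanation of call `i` has positive literals only, so call `j` satisfies it by containing
  -- the opposite of one; consistency excludes the literal itself.
  earlier-broken : ∀ {i j} → i Fin.< j →
    ∃[ w ] (w Subset.∈ explained i × ¬ T (literals (A j) (𝐓 (x w d))))
  earlier-broken {i} {j} i<j with satPrev h j i i<j
  ... | inj₁ (a , Ta∈ , Fa∈A) with proj₁ (explanation≐ i) Ta∈
  ...   | w , w∈ , refl = w , w∈ , λ Ta∈A → consistent (A j) a (Ta∈A , Fa∈A)
  earlier-broken {i} {j} i<j | inj₂ (a , Fa∈ , _) with proj₁ (explanation≐ i) Fa∈
  ...   | _ , _ , ()

PCH-length : ∀ {n k d m} → (N : Network n d) → IsSortingNetwork N →
  (π : Propagator (At (ASP N ∪ᴾ Binomial n k)) (OutputConstraint n k d)) →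
  {A : Vector (Assignment (At (ASP N ∪ᴾ Binomial n k))) m} →
  PCH (ASP N ∪ᴾ Binomial n k) π A → m ≤ suc (n ∸ k)
PCH-length {k = zero} {m = zero}        _ _     _ _ = z≤n
PCH-length {k = zero} {m = suc zero}    _ _     _ _ = s≤s z≤n
PCH-length {k = zero} {m = suc (suc m)} N sorts π h
  -- For `k = 0` the second call would have to falsify an output from an empty set.
  with earlier-broken N sorts π h {zero} {suc zero} (s≤s z≤n)
... | _ , w∈ , _ = contradiction w∈ (∣W∣≡0⇒∉ (∣explained∣ N sorts π h zero))
-- Least wires are at most `n ∸ suc k`, so they embed the calls into `Fin (suc (n ∸ suc k))`.
PCH-length {n} {suc k} {m = m} N sorts π h = strictMono⇒≤ (λ i → fromℕ< (bounded i)) λ {i} {j} i<j →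
  subst₂ ℕ._<_ (sym (Fin.toℕ-fromℕ< (bounded i))) (sym (Fin.toℕ-fromℕ< (bounded j)))
    (increasing i<j)
  where
  leastOf : ∀ i → _
  leastOf i = least (explained N sorts π h i) (∣explained∣ N sorts π h i)

  w : Fin m → Fin n
  w i = proj₁ (leastOf i)

  bounded : ∀ i → suc (toℕ (w i)) ≤ suc (n ∸ suc k)
  bounded i = s≤s (ℕ.m+n≤o⇒m≤o∸n (toℕ (w i)) (proj₂ (proj₂ (proj₂ (leastOf i)))))

  increasing : ∀ {i j} → i Fin.< j → w i Fin.< w j
  increasing {i} {j} i<j with earlier-broken N sorts π h i<j
  -- If `w j` were at most `w i`, it would lie at or below `v`, since `w i` is least in its set.
  -- Output `w j` is true in call `j`, so `v` would be true there as well.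
  ... | v , v∈ , v-false = ℕ.≰⇒> λ wⱼ≤wᵢ → v-false
    (true-upward N sorts π h j
      (Fin.≤-trans wⱼ≤wᵢ (proj₁ (proj₂ (proj₂ (leastOf i))) v∈))
      (explained-true N sorts π h j (proj₁ (proj₂ (leastOf j)))))

proposition3 : (n k d : ℕ) → k ≤ n →
    (N : Network n d) → IsSortingNetwork N →
    (π : Propagator (At (ASP N ∪ᴾ Binomial n k)) (OutputConstraint n k d)) →
    (m : ℕ) (A : Vector (Assignment (At (ASP N ∪ᴾ Binomial n k))) m) →
    CompletePCH (ASP N ∪ᴾ Binomial n k) π A →
    m ≤ n ∸ k + 1
proposition3 n k d k≤n N sorts π m A complete =
  subst (m ≤_) (ℕ.+-comm 1 (n ∸ k)) (PCH-length N sorts π (CompletePCH.pch complete))
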